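{- Let $G$ be a finite Eulerian graph (every vertex has even degree) in which every edge is labelled $o$ or $s$, and let $g(G)$ be the number of balanced factorientations of $G$ with respect to these labels. Then $g(G)\leq \varepsilon(G)$, where $\varepsilon(G)$ is the number of Eulerian orientations of $G$.
   Context: A factorientation of a graph whose edges are labelled $o$ or $s$ consists of orienting every $o$-edge and deciding for every $s$-edge whether it is selected or not. The mixed degree of a vertex $v$ is the number of $o$-edges oriented towards $v$ plus the number of selected $s$-edges incident to $v$. A factorientation is balanced if every vertex $v$ has mixed degree $d_G(v)/2$. An Eulerian orientation is an orientation in which every vertex has in-degree equal to out-degree. -}

module Defs where

open import Data.Empty using (⊥)
open import Data.Fin.Base using (Fin; zero; suc)
open import Data.Fin.Properties using (_≟_; all?)
open import Data.List.Base using (List; []; _∷_; length; filter; allFin; cartesianProductWith)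
open import Data.List.Membership.Propositional using (_∈_)
import Data.List.Membership.Setoid as SetoidMembership
open import Data.List.Relation.Unary.All using ([]; _∷_)
open import Data.List.Relation.Unary.AllPairs using ([]; _∷_)
open import Data.List.Relation.Unary.Any using (here; there)
import Data.List.Relation.Unary.Any.Properties as Any
open import Data.List.Relation.Unary.Unique.Propositional using (Unique)
import Data.List.Relation.Unary.Unique.Setoid as SetoidUnique
import Data.List.Relation.Unary.Unique.Setoid.Properties as SetoidUniqueₚ
open import Data.Nat.Base using (ℕ; zero; suc; _+_)
open import Data.Nat.Divisibility using (_∣_)
open import Data.Nat.DivMod using (_/_)
import Data.Nat.Properties as ℕ
open import Data.Product.Base using (_,_)
open import Data.Sum.Base using (_⊎_)
open import Level using (0ℓ)
open import Relation.Binary.Bundles using (Setoid)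
open import Relation.Binary.PropositionalEquality using (_≡_; _≢_; refl; sym; trans; setoid)
open import Relation.Nullary.Decidable using (Dec; no; _⊎-dec_)
open import Relation.Unary using (Pred; Decidable)

-- Finite loopless graphs; parallel edges are allowed, and the simple graphs
-- are those in which no two edges have the same pair of endpoints.  The names
-- src/tgt only fix an arbitrary reference order of the two endpoints.
record Graph : Set where
  field
    order    : ℕ
    size     : ℕ
    src tgt  : Fin size → Fin order
    loopless : ∀ e → src e ≢ tgt e

  Vertex : Set
  Vertex = Fin order

  Edge : Set
  Edge = Fin size

  Incident : Vertex → Edge → Set
  Incident v e = src e ≡ v ⊎ tgt e ≡ v

  incident? : ∀ v → Decidable (Incident v)
  incident? v e = (src e ≟ v) ⊎-dec (tgt e ≟ v)

  #edges : {P : Pred Edge 0ℓ} → Decidable P → ℕ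
  #edges P? = length (filter P? (allFin size))

  degree : Vertex → ℕ
  degree v = #edges (incident? v)

  Eulerian : Set
  Eulerian = ∀ v → 2 ∣ degree v

open Graph using (Eulerian) public

data Direction : Set where
  towardsTgt towardsSrc : Direction

data Selection : Set where
  selected unselected : Selection

data Label : Set where
  o s : Label

Choice : Label → Set
Choice o = Direction
Choice s = Selection

allDirections : List Direction
allDirections = towardsTgt ∷ towardsSrc ∷ []

allChoices : ∀ l → List (Choice l)
allChoices o = allDirections
allChoices s = selected ∷ unselected ∷ []

consᶠ : ∀ {m} {C : Fin (suc m) → Set} → C zero → (∀ i → C (suc i)) → ∀ i → C i
consᶠ c f zero    = c
consᶠ c f (suc i) = f i

-- All dependent functions choosing from given finite lists; each occurs exactly
-- once up to pointwise equality (see functions-complete and functions-unique).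
functions : ∀ {m} {C : Fin m → Set} → (∀ i → List (C i)) → List (∀ i → C i)
functions {zero}  cs = (λ ()) ∷ []
functions {suc m} cs = cartesianProductWith consᶠ (cs zero) (functions (λ i → cs (suc i)))

module _ (G : Graph) where
  open Graph G

  Orientation : Set
  Orientation = Edge → Direction

  head tail : Edge → Direction → Vertex
  head e towardsTgt = tgt e
  head e towardsSrc = src e
  tail e towardsTgt = src e
  tail e towardsSrc = tgt e

  inDegree outDegree : Orientation → Vertex → ℕ
  inDegree  ω v = #edges (λ e → head e (ω e) ≟ v)
  outDegree ω v = #edges (λ e → tail e (ω e) ≟ v)

  IsEulerianOrientation : Pred Orientation 0ℓ
  IsEulerianOrientation ω = ∀ v → inDegree ω v ≡ outDegree ω v

  isEulerianOrientation? : Decidable IsEulerianOrientation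
  isEulerianOrientation? ω = all? (λ v → inDegree ω v ℕ.≟ outDegree ω v)

  ε : ℕ
  ε = length (filter isEulerianOrientation? (functions (λ (_ : Edge) → allDirections)))

  Labelling : Set
  Labelling = Edge → Label

  OrientedTowards : Vertex → Edge → ∀ l → Choice l → Set
  OrientedTowards v e o d = head e d ≡ v
  OrientedTowards v e s _ = ⊥

  SelectedAt : Vertex → Edge → ∀ l → Choice l → Set
  SelectedAt v e o _          = ⊥
  SelectedAt v e s selected   = Incident v e
  SelectedAt v e s unselected = ⊥

  orientedTowards? : ∀ v e l c → Dec (OrientedTowards v e l c)
  orientedTowards? v e o d = head e d ≟ v
  orientedTowards? v e s _ = no λ ()

  selectedAt? : ∀ v e l c → Dec (SelectedAt v e l c)
  selectedAt? v e o _          = no λ ()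
  selectedAt? v e s selected   = incident? v e
  selectedAt? v e s unselected = no λ ()

  module _ (lab : Labelling) where

    Factorientation : Set
    Factorientation = ∀ e → Choice (lab e)

    mixedDegree : Factorientation → Vertex → ℕ
    mixedDegree φ v = #edges (λ e → orientedTowards? v e (lab e) (φ e))
                    + #edges (λ e → selectedAt? v e (lab e) (φ e))

    -- For Eulerian graphs the division by 2 is exact.
    Balanced : Pred Factorientation 0ℓ
    Balanced φ = ∀ v → mixedDegree φ v ≡ degree v / 2

    balanced? : Decidable Balanced
    balanced? φ = all? (λ v → mixedDegree φ v ℕ.≟ degree v / 2)

    g : ℕ
    g = length (filter balanced? (functions (λ e → allChoices (lab e))))

≗-setoid : ∀ {m} → (Fin m → Set) → Setoid 0ℓ 0ℓ
≗-setoid C = record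
  { Carrier       = ∀ i → C i
  ; _≈_           = λ f h → ∀ i → f i ≡ h i
  ; isEquivalence = record
    { refl  = λ _ → refl
    ; sym   = λ p i → sym (p i)
    ; trans = λ p q i → trans (p i) (q i)
    }
  }

functions-complete : ∀ {m} {C : Fin m → Set} (cs : ∀ i → List (C i)) (f : ∀ i → C i) →
                     (∀ i → f i ∈ cs i) →
                     SetoidMembership._∈_ (≗-setoid C) f (functions cs)
functions-complete {zero}  cs f f∈ = here λ ()
functions-complete {suc m} cs f f∈ =
  Any.cartesianProductWith⁺ consᶠ (λ { p q zero → p ; p q (suc i) → q i })
    (f∈ zero) (functions-complete (λ i → cs (suc i)) (λ i → f (suc i)) (λ i → f∈ (suc i)))

functions-unique : ∀ {m} {C : Fin m → Set} (cs : ∀ i → List (C i)) →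
                   (∀ i → Unique (cs i)) →
                   SetoidUnique.Unique (≗-setoid C) (functions cs)
functions-unique {zero}      cs cs! = [] ∷ []
functions-unique {suc m} {C} cs cs! =
  SetoidUniqueₚ.cartesianProductWith⁺ (setoid (C zero)) (≗-setoid (λ i → C (suc i))) (≗-setoid C)
    consᶠ (λ p → p zero , λ i → p (suc i))
    (cs! zero) (functions-unique (λ i → cs (suc i)) (λ i → cs! (suc i)))

allChoices-complete : ∀ l (c : Choice l) → c ∈ allChoices l
allChoices-complete o towardsTgt = here refl
allChoices-complete o towardsSrc = there (here refl)
allChoices-complete s selected   = here refl
allChoices-complete s unselected = there (here refl)

allChoices-unique : ∀ l → Unique (allChoices l)
allChoices-unique o = ((λ ()) ∷ []) ∷ [] ∷ []
allChoices-unique s = ((λ ()) ∷ []) ∷ [] ∷ []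

{-# OPTIONS --safe #-}
module Submission where

-- Both counts are the coefficient of ∏ x_v^(d(v)/2) in a product over the edges uv,
-- with factor x_u + x_v for an o-edge and 1 + x_u x_v for an s-edge (ε is the case
-- where all labels are o).  For x_v = e^(iθ_v) these factors are, up to a phase,
-- 2 cos ((θ_u - θ_v)/2) and 2 cos ((θ_u + θ_v)/2), that is 2 (c_u c_v ± s_u s_v) with
-- c_v = cos (θ_v/2), s_v = sin (θ_v/2).  Expanding, every term is plus or minus a
-- product over v of averages of c_v^p s_v^q with p + q = d(v), which are nonnegative;
-- for ε all signs are +, so g ≤ ε by the triangle inequality.  Algebraically, c and s
-- are replaced by 1 + x and 1 - x, and the averages by the middle coefficient of
-- (1 + x)^p (1 - x)^q, which vanishes for odd q and has sign (-1)^(q/2) for even q.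

open import Defs
open import Data.Nat.Base using (_≤_)
open import Data.Bool.Base using (true; false; if_then_else_)
open import Data.Fin.Base using (Fin; zero; suc)
import Data.Fin.Properties as Fin
open import Data.Integer.Base as ℤ using (ℤ; +_; 0ℤ; 1ℤ; -1ℤ; ∣_∣; _+_; _*_; _-_; -_; _^_; +≤+)
import Data.Integer.Properties as ℤ
open import Data.Integer.Tactic.RingSolver using (solve-∀)
open import Data.List.Base using ([]; _∷_; _++_; length; filter; map; tabulate; cartesianProductWith)
open import Data.List.Properties using (filter-++; filter-≐; length-++)
open import Data.Nat.Base as ℕ using (ℕ; zero; suc; z≤n)
open import Data.Nat.DivMod using (_/_; m*[n/m]≡n)
import Data.Nat.ListAction as List
import Data.Nat.Properties as ℕ
import Data.Nat.Tactic.RingSolver as ℕSolver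
open import Data.Product.Base using (∃; _×_; _,_; proj₁; proj₂)
open import Data.Sum.Base using (_⊎_; inj₁; inj₂)
open import Level using (0ℓ)
open import Relation.Binary.PropositionalEquality using (_≡_; _≢_; _≗_; refl; sym; trans; cong; cong₂; subst; module ≡-Reasoning)
open import Relation.Nullary using (¬_; contradiction; does; yes; no; Dec)
open import Relation.Unary using (Pred; Decidable; _≐_)

open import Algebra.Properties.CommutativeMonoid.Sum ℕ.+-0-commutativeMonoid using (sum; sum-cong-≗; sum-replicate-zero; ∑-distrib-+)
open import Algebra.Properties.CommutativeSemigroup ℤ.+-commutativeSemigroup using (interchange)
open import Algebra.Properties.CommutativeMonoid.Sum ℤ.*-1-commutativeMonoid using () renaming (sum to product; sum-cong-≗ to product-cong)

-- Polynomials in one variable as coefficient sequences.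

Poly : Set
Poly = ℕ → ℤ

X·_ : Poly → Poly
(X· f) zero    = 0ℤ
(X· f) (suc n) = f n

[1+X]·_ [1-X]·_ : Poly → Poly
([1+X]· f) n = f n + (X· f) n
([1-X]· f) n = f n - (X· f) n

infixr 9 X·_ [1+X]·_ [1-X]·_

indicator : ∀ {a} {A : Set a} → Dec A → ℕ
indicator a? = if does a? then 1 else 0

indicator-yes : ∀ {a} {A : Set a} (a? : Dec A) → A → indicator a? ≡ 1
indicator-yes (yes _) a = refl
indicator-yes (no ¬a) a = contradiction a ¬a

indicator-no : ∀ {a} {A : Set a} (a? : Dec A) → ¬ A → indicator a? ≡ 0
indicator-no (yes a) ¬a = contradiction a ¬a
indicator-no (no _)  ¬a = refl

monomial : ℕ → Poly
monomial a n = + indicator (a ℕ.≟ n)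

X·-cong : ∀ {f g} → f ≗ g → X· f ≗ X· g
X·-cong f≗g zero    = refl
X·-cong f≗g (suc n) = f≗g n

X·-+ : ∀ {f g h} → (∀ n → f n ≡ g n + h n) → ∀ n → (X· f) n ≡ (X· g) n + (X· h) n
X·-+ f≡g+h zero    = refl
X·-+ f≡g+h (suc n) = f≡g+h n

X·[1+X]· : ∀ f n → (X· [1+X]· f) n ≡ (X· f) n + (X· X· f) n
X·[1+X]· f zero    = refl
X·[1+X]· f (suc n) = refl

X·[1-X]· : ∀ f n → (X· [1-X]· f) n ≡ (X· f) n - (X· X· f) n
X·[1-X]· f zero    = refl
X·[1-X]· f (suc n) = refl

[1+X]·-cong : ∀ {f g} → f ≗ g → [1+X]· f ≗ [1+X]· g
[1+X]·-cong f≗g n = cong₂ _+_ (f≗g n) (X·-cong f≗g n)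

[1-X]·-cong : ∀ {f g} → f ≗ g → [1-X]· f ≗ [1-X]· g
[1-X]·-cong f≗g n = cong₂ _-_ (f≗g n) (X·-cong f≗g n)

[1-X]·[1+X]·-expand : ∀ f n → ([1-X]· [1+X]· f) n ≡ f n - (X· X· f) n
[1-X]·[1+X]·-expand f n rewrite X·[1+X]· f n = lemma (f n) ((X· f) n) ((X· X· f) n)
  where
  lemma : ∀ a b c → a + b - (b + c) ≡ a - c
  lemma = solve-∀

[1+X]·[1-X]·-expand : ∀ f n → ([1+X]· [1-X]· f) n ≡ f n - (X· X· f) n
[1+X]·[1-X]·-expand f n rewrite X·[1-X]· f n = lemma (f n) ((X· f) n) ((X· X· f) n)
  where
  lemma : ∀ a b c → a - b + (b - c) ≡ a - c
  lemma = solve-∀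

-- The products (1 + x)^p (1 - x)^q.

[1+X]^_·[1-X]^_ : ℕ → ℕ → Poly
[1+X]^ zero  ·[1-X]^ zero  = monomial 0
[1+X]^ zero  ·[1-X]^ suc q = [1-X]· [1+X]^ zero ·[1-X]^ q
[1+X]^ suc p ·[1-X]^ q     = [1+X]· [1+X]^ p ·[1-X]^ q

-- The recursion peels off all factors 1 + x before the factors 1 - x, so a new factor 1 - x has to
-- be moved past them; in either order, a pair of factors acts as 1 - x².
[1-X]·-power : ∀ p q → [1-X]· [1+X]^ p ·[1-X]^ q ≗ [1+X]^ p ·[1-X]^ suc q
[1-X]·-power zero    q n = refl
[1-X]·-power (suc p) q n = begin
  ([1-X]· [1+X]· f) n              ≡⟨ [1-X]·[1+X]·-expand f n ⟩
  f n - (X· X· f) n                ≡⟨ [1+X]·[1-X]·-expand f n ⟨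
  ([1+X]· [1-X]· f) n              ≡⟨ [1+X]·-cong ([1-X]·-power p q) n ⟩
  ([1+X]^ suc p ·[1-X]^ suc q) n   ∎
  where
  open ≡-Reasoning
  f = [1+X]^ p ·[1-X]^ q

-- Recurrences for the coefficients.

-- Reduces an identity that holds modulo known equations to a pure ring identity: the equation
-- `l ≡ r` enters as the vanishing summand `l - r`, with its coefficients found by hand.
by-linearity : ∀ {l r x y : ℤ} → l ≡ r → x ≡ y + (l - r) → x ≡ y
by-linearity {l} {r} {x} {y} l≡r x≡ = begin
  x             ≡⟨ x≡ ⟩
  y + (l - r)   ≡⟨ cong (λ z → y + z) (ℤ.i≡j⇒i-j≡0 l≡r) ⟩
  y + 0ℤ        ≡⟨ ℤ.+-identityʳ y ⟩
  y             ∎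
  where open ≡-Reasoning

-- (1 - x²) x f′ = (p (x - x²) - q (x + x²)) f  for  f = (1 + x)ᵖ (1 - x)^q, coefficientwise.
Recurrence : ℕ → ℕ → Poly → Set
Recurrence p q f = ∀ n →
  + n * f n ≡ (+ p - + q) * (X· f) n + (+ n - + 2 - + p - + q) * (X· X· f) n

-- The recurrence at n - 1, written with `X·_` so that n = 0 is included; there all terms vanish.
recurrence-shift : ∀ p q f → Recurrence p q f → ∀ n →
  (+ n - 1ℤ) * (X· f) n ≡ (+ p - + q) * (X· X· f) n + (+ n - + 3 - + p - + q) * (X· X· X· f) n
recurrence-shift p q f rec zero = lemma (+ p) (+ q)
  where
  lemma : ∀ p q → (0ℤ - 1ℤ) * 0ℤ ≡ (p - q) * 0ℤ + (0ℤ - + 3 - p - q) * 0ℤ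
  lemma = solve-∀
recurrence-shift p q f rec (suc n) =
  by-linearity (rec n) (lemma (+ n) (+ p) (+ q) (f n) ((X· f) n) ((X· X· f) n))
  where
  lemma : ∀ n p q a b c → (1ℤ + n - 1ℤ) * a ≡
    (p - q) * b + (1ℤ + n - + 3 - p - q) * c +
    (n * a - ((p - q) * b + (n - + 2 - p - q) * c))
  lemma = solve-∀

-- The sum of the recurrence for f at n and at n - 1.
recurrence-[1+X]· : ∀ p q f → Recurrence p q f → Recurrence (suc p) q ([1+X]· f)
recurrence-[1+X]· p q f rec n
  rewrite X·-+ (X·[1+X]· f) n | X·[1+X]· f n =
  by-linearity (rec n) (by-linearity (recurrence-shift p q f rec n)
    (lemma (+ n) (+ p) (+ q) (f n) ((X· f) n) ((X· X· f) n) ((X· X· X· f) n)))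
  where
  lemma : ∀ n p q a b c d → n * (a + b) ≡
    (1ℤ + p - q) * (b + c) + (n - + 2 - (1ℤ + p) - q) * (c + d) +
    (n * a - ((p - q) * b + (n - + 2 - p - q) * c)) +
    ((n - 1ℤ) * b - ((p - q) * c + (n - + 3 - p - q) * d))
  lemma = solve-∀

X·X·[1-X]· : ∀ f n → (X· X· [1-X]· f) n ≡ (X· X· f) n - (X· X· X· f) n
X·X·[1-X]· f zero    = refl
X·X·[1-X]· f (suc n) = X·[1-X]· f n

recurrence-[1-X]· : ∀ p q f → Recurrence p q f → Recurrence p (suc q) ([1-X]· f)
recurrence-[1-X]· p q f rec n
  rewrite X·X·[1-X]· f n | X·[1-X]· f n =
  -- For the factor 1 - x the shifted recurrence is subtracted, hence `sym`.
  by-linearity (rec n) (by-linearity (sym (recurrence-shift p q f rec n))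
    (lemma (+ n) (+ p) (+ q) (f n) ((X· f) n) ((X· X· f) n) ((X· X· X· f) n)))
  where
  lemma : ∀ n p q a b c d → n * (a - b) ≡
    (p - (1ℤ + q)) * (b - c) + (n - + 2 - p - (1ℤ + q)) * (c - d) +
    (n * a - ((p - q) * b + (n - + 2 - p - q) * c)) +
    ((p - q) * c + (n - + 3 - p - q) * d - (n - 1ℤ) * b)
  lemma = solve-∀

recurrence : ∀ p q → Recurrence p q ([1+X]^ p ·[1-X]^ q)
recurrence zero zero zero                = refl
recurrence zero zero (suc zero)          = refl
recurrence zero zero (suc (suc zero))    = refl
recurrence zero zero (suc (suc (suc n))) =
  lemma (+ n)
  where
  lemma : ∀ n → (+ 3 + n) * 0ℤ ≡ (0ℤ - 0ℤ) * 0ℤ + (+ 3 + n - + 2 - 0ℤ - 0ℤ) * 0ℤ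
  lemma = solve-∀
recurrence zero (suc q)    = recurrence-[1-X]· zero q _ (recurrence zero q)
recurrence (suc p) q       = recurrence-[1+X]· p q _ (recurrence p q)

-- The ratio rule n C(p,n) = (p + 1 - n) C(p,n-1). It is of first order and concerns q = 0; it
-- serves the base case q = 1 of the sign computation.
BinomialRecurrence : ℕ → Poly → Set
BinomialRecurrence p f = ∀ n → + n * f n ≡ (1ℤ + + p - + n) * (X· f) n

binomialRecurrence-shift : ∀ p f → BinomialRecurrence p f → ∀ n →
  (+ n - 1ℤ) * (X· f) n ≡ (+ 2 + + p - + n) * (X· X· f) n
binomialRecurrence-shift p f rec zero = lemma (+ p)
  where
  lemma : ∀ p → (0ℤ - 1ℤ) * 0ℤ ≡ (+ 2 + p - 0ℤ) * 0ℤ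
  lemma = solve-∀
binomialRecurrence-shift p f rec (suc n) =
  by-linearity (rec n) (lemma (+ n) (+ p) (f n) ((X· f) n))
  where
  lemma : ∀ n p a b → (1ℤ + n - 1ℤ) * a ≡
    (+ 2 + p - (1ℤ + n)) * b + (n * a - (1ℤ + p - n) * b)
  lemma = solve-∀

binomialRecurrence : ∀ p → BinomialRecurrence p ([1+X]^ p ·[1-X]^ 0)
binomialRecurrence zero zero          = refl
binomialRecurrence zero (suc zero)    = refl
binomialRecurrence zero (suc (suc n)) = lemma (+ n)
  where
  lemma : ∀ n → (+ 2 + n) * 0ℤ ≡ (1ℤ + 0ℤ - (+ 2 + n)) * 0ℤ
  lemma = solve-∀
binomialRecurrence (suc p) n rewrite X·[1+X]· ([1+X]^ p ·[1-X]^ 0) n =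
  by-linearity (binomialRecurrence p n)
    (by-linearity (binomialRecurrence-shift p f (binomialRecurrence p) n)
      (lemma (+ n) (+ p) (f n) ((X· f) n) ((X· X· f) n)))
  where
  f = [1+X]^ p ·[1-X]^ 0
  lemma : ∀ n p a b c → n * (a + b) ≡ (1ℤ + (1ℤ + p) - n) * (b + c) +
    (n * a - (1ℤ + p - n) * b) + ((n - 1ℤ) * b - (+ 2 + p - n) * c)
  lemma = solve-∀

-- Signs of the middle coefficients.

binomial-nonneg : ∀ p n → 0ℤ ℤ.≤ ([1+X]^ p ·[1-X]^ 0) n
binomial-nonneg zero    n       = +≤+ z≤n
binomial-nonneg (suc p) zero    = ℤ.+-mono-≤ (binomial-nonneg p zero) (+≤+ z≤n)
binomial-nonneg (suc p) (suc n) = ℤ.+-mono-≤ (binomial-nonneg p (suc n)) (binomial-nonneg p n)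

-- Symmetry of binomial coefficients: the coefficient of x^(m+1) in (1 - x²) (1 + x)^(2m) is
-- C(2m,m+1) - C(2m,m-1).
middle-one : ∀ p h → p ℕ.+ 1 ≡ 2 ℕ.* h → ([1+X]^ p ·[1-X]^ 1) h ≡ 0ℤ
middle-one zero    zero    ()
middle-one zero    (suc h) eq =
  contradiction (trans (ℕ.suc-injective eq) (ℕ.+-suc h (h ℕ.+ 0))) λ ()
middle-one (suc p) zero    ()
middle-one (suc p) (suc h) eq = begin
  ([1+X]^ suc p ·[1-X]^ 1) (suc h)    ≡⟨ [1-X]·-power (suc p) 0 (suc h) ⟨
  ([1-X]· [1+X]· f) (suc h)           ≡⟨ [1-X]·[1+X]·-expand f (suc h) ⟩
  f (suc h) - (X· f) h                ≡⟨ ℤ.*-cancelˡ-≡ (+ suc h) _ _ zero-multiple ⟩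
  0ℤ                                  ∎
  where
  open ≡-Reasoning
  f = [1+X]^ p ·[1-X]^ 0
  p≡2h : + p ≡ + h + + h
  p≡2h = cong +_ (ℕ.+-cancelʳ-≡ 2 p (h ℕ.+ h) (trans (lemma p) (trans eq (lemma′ h))))
    where
    lemma : ∀ p → p ℕ.+ 2 ≡ suc p ℕ.+ 1
    lemma = ℕSolver.solve-∀
    lemma′ : ∀ h → 2 ℕ.* suc h ≡ h ℕ.+ h ℕ.+ 2
    lemma′ = ℕSolver.solve-∀
  zero-multiple : + suc h * (f (suc h) - (X· f) h) ≡ + suc h * 0ℤ
  zero-multiple =
    -- With p = 2h, the ratio rule at h + 1 and at h gives (h + 1) C(p,h+1) = h C(p,h) = (h + 1)
    -- C(p,h-1).
    by-linearity (binomialRecurrence p (suc h))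
      (by-linearity (binomialRecurrence p h)
        (by-linearity (cong (λ z → z * (f h + (X· f) h)) p≡2h)
          (lemma (+ h) (+ p) (f (suc h)) (f h) ((X· f) h))))
    where
    lemma : ∀ h p a b c → (1ℤ + h) * (a - c) ≡ (1ℤ + h) * 0ℤ +
      ((1ℤ + h) * a - (1ℤ + p - (1ℤ + h)) * b) + (h * b - (1ℤ + p - h) * c) +
      (p * (b + c) - (h + h) * (b + c))
    lemma = solve-∀

-- The discrete form of ∫ (cos^(p+1) sin^(q+1))′ = 0 over a period.
middle-exchange : ∀ p q h → p ℕ.+ suc (suc q) ≡ 2 ℕ.* h →
  + suc p * ([1+X]^ p ·[1-X]^ suc (suc q)) h ≡ - (+ suc q * ([1+X]^ suc (suc p) ·[1-X]^ q) h)
middle-exchange p q h eq = begin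
  + suc p * ([1+X]^ p ·[1-X]^ suc (suc q)) h
    ≡⟨ cong (λ z → + suc p * z) (sym (trans ([1-X]·-cong ([1-X]·-power p q) h) ([1-X]·-power p (suc q) h))) ⟩
  + suc p * (f h - (X· f) h - (X· [1-X]· f) h)
    ≡⟨ cong (λ z → + suc p * (f h - (X· f) h - z)) (X·[1-X]· f h) ⟩
  + suc p * (f h - (X· f) h - ((X· f) h - (X· X· f) h))
    -- Since p + q + 2 = 2h, the recurrence at h reads h (a + c) = (p - q) b for the coefficients a,
    -- b, c of f at h, h - 1, h - 2. Twice this equation is the claim, expanded.
    ≡⟨ by-linearity (cong (λ z → + 2 * z) (recurrence p q h))
        (by-linearity (cong (λ z → z * (f h - (X· X· f) h)) size)
          (lemma (+ h) (+ p) (+ q) (f h) ((X· f) h) ((X· X· f) h))) ⟩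
  - (+ suc q * (f h + (X· f) h + ((X· f) h + (X· X· f) h)))
    ≡⟨ cong (λ z → - (+ suc q * (f h + (X· f) h + z))) (X·[1+X]· f h) ⟨
  - (+ suc q * ([1+X]^ suc (suc p) ·[1-X]^ q) h) ∎
  where
  open ≡-Reasoning
  f = [1+X]^ p ·[1-X]^ q
  size : + p + (+ 2 + + q) ≡ + 2 * + h
  size = trans (cong +_ eq) (ℤ.pos-* 2 h)
  lemma : ∀ h p q a b c → (1ℤ + p) * (a - b - (b - c)) ≡
    - ((1ℤ + q) * (a + b + (b + c))) +
    (+ 2 * (h * a) - + 2 * ((p - q) * b + (h - + 2 - p - q) * c)) +
    ((p + (+ 2 + q)) * (a - c) - + 2 * h * (a - c))
  lemma = solve-∀

-- x ∈ ℝ≥0 · iʲ, for real x.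
HasPhase : ℕ → ℤ → Set
HasPhase j x = x ≡ 0ℤ ⊎ ∃ λ k → j ≡ 2 ℕ.* k × 0ℤ ℤ.≤ -1ℤ ^ k * x

-- Induction on q in steps of two: `middle-exchange` trades (1 - x)² for (1 + x)² at the cost of a
-- sign and a positive ratio. The chain ends in a binomial coefficient for even q and in
-- `middle-one` for odd q.
middle-phase : ∀ q p h → p ℕ.+ q ≡ 2 ℕ.* h → HasPhase q (([1+X]^ p ·[1-X]^ q) h)
middle-phase zero p h eq =
  inj₂ (0 , refl , subst (0ℤ ℤ.≤_) (sym (ℤ.*-identityˡ _)) (binomial-nonneg p h))
middle-phase (suc zero) p h eq = inj₁ (middle-one p h eq)
middle-phase (suc (suc q)) p h eq
  with middle-phase q (suc (suc p)) h (trans (lemma p q) eq)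
  where
  lemma : ∀ p q → suc (suc p) ℕ.+ q ≡ p ℕ.+ suc (suc q)
  lemma = ℕSolver.solve-∀
... | inj₁ x≡0 = inj₁ (ℤ.*-cancelˡ-≡ (+ suc p) _ _ (begin
  + suc p * ([1+X]^ p ·[1-X]^ suc (suc q)) h           ≡⟨ middle-exchange p q h eq ⟩
  - (+ suc q * ([1+X]^ suc (suc p) ·[1-X]^ q) h)       ≡⟨ cong (λ z → - (+ suc q * z)) x≡0 ⟩
  - (+ suc q * 0ℤ)                                     ≡⟨ cong -_ (ℤ.*-zeroʳ (+ suc q)) ⟩
  0ℤ                                                   ≡⟨ ℤ.*-zeroʳ (+ suc p) ⟨
  + suc p * 0ℤ                                         ∎))
  where open ≡-Reasoning
... | inj₂ (k , q≡2k , 0≤x) = inj₂ (suc k , trans (cong (λ z → suc (suc z)) q≡2k) (lemma k) ,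
  ℤ.*-cancelˡ-≤-pos 0ℤ _ (+ suc p) (begin
    + suc p * 0ℤ                       ≡⟨ ℤ.*-zeroʳ (+ suc p) ⟩
    0ℤ                                 ≡⟨ ℤ.*-zeroʳ (+ suc q) ⟨
    + suc q * 0ℤ                       ≤⟨ ℤ.*-monoˡ-≤-nonNeg (+ suc q) 0≤x ⟩
    + suc q * (-1ℤ ^ k * y)            ≡⟨ lemma₁ (-1ℤ ^ k) (+ suc q) y ⟩
    -1ℤ * -1ℤ ^ k * - (+ suc q * y)    ≡⟨ cong (λ z → -1ℤ * -1ℤ ^ k * z) (middle-exchange p q h eq) ⟨
    -1ℤ * -1ℤ ^ k * (+ suc p * x)      ≡⟨ lemma₂ (-1ℤ * -1ℤ ^ k) (+ suc p) x ⟩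
    + suc p * (-1ℤ ^ suc k * x)        ∎))
  where
  open ℤ.≤-Reasoning
  x = ([1+X]^ p ·[1-X]^ suc (suc q)) h
  y = ([1+X]^ suc (suc p) ·[1-X]^ q) h
  lemma : ∀ k → suc (suc (2 ℕ.* k)) ≡ 2 ℕ.* suc k
  lemma = ℕSolver.solve-∀
  lemma₁ : ∀ e q y → q * (e * y) ≡ -1ℤ * e * - (q * y)
  lemma₁ = solve-∀
  lemma₂ : ∀ e p x → e * (p * x) ≡ p * (e * x)
  lemma₂ = solve-∀

phase-* : ∀ {i j x y} → HasPhase i x → HasPhase j y → HasPhase (i ℕ.+ j) (x * y)
phase-* (inj₁ refl) _ = inj₁ refl
phase-* {x = x} (inj₂ _) (inj₁ refl) = inj₁ (ℤ.*-zeroʳ x)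
phase-* {x = x} {y} (inj₂ (k , refl , 0≤x)) (inj₂ (l , refl , 0≤y)) =
  inj₂ (k ℕ.+ l , sym (ℕ.*-distribˡ-+ 2 k l) , (begin
    0ℤ                                ≡⟨ ℤ.*-zeroʳ (-1ℤ ^ k * x) ⟨
    -1ℤ ^ k * x * 0ℤ                  ≤⟨ ℤ.*-monoˡ-≤-nonNeg (-1ℤ ^ k * x) {{ℤ.nonNegative 0≤x}} 0≤y ⟩
    -1ℤ ^ k * x * (-1ℤ ^ l * y)       ≡⟨ lemma (-1ℤ ^ k) (-1ℤ ^ l) x y ⟩
    -1ℤ ^ k * -1ℤ ^ l * (x * y)       ≡⟨ cong (_* (x * y)) (ℤ.^-distribˡ-+-* -1ℤ k l) ⟨
    -1ℤ ^ (k ℕ.+ l) * (x * y)         ∎))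
  where
  open ℤ.≤-Reasoning
  lemma : ∀ e f x y → e * x * (f * y) ≡ e * f * (x * y)
  lemma = solve-∀

abs-sign : ∀ k → ∣ -1ℤ ^ k ∣ ≡ 1
abs-sign zero    = refl
abs-sign (suc k) = trans (ℤ.abs-* -1ℤ (-1ℤ ^ k)) (trans (ℕ.*-identityˡ _) (abs-sign k))

-- Since i^(2k) = (-1)^k, multiplication by (-1)^k makes x nonnegative.
phase-abs : ∀ {x} k → HasPhase (2 ℕ.* k) x → + ∣ x ∣ ℤ.≤ -1ℤ ^ k * x
phase-abs k (inj₁ refl) = ℤ.≤-reflexive (sym (ℤ.*-zeroʳ (-1ℤ ^ k)))
phase-abs {x} k (inj₂ (l , 2k≡2l , 0≤x)) with refl ← ℕ.*-cancelˡ-≡ k l 2 2k≡2l = begin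
  + ∣ x ∣                    ≡⟨ cong +_ (ℕ.*-identityˡ ∣ x ∣) ⟨
  + (1 ℕ.* ∣ x ∣)            ≡⟨ cong (λ z → + (z ℕ.* ∣ x ∣)) (abs-sign k) ⟨
  + (∣ -1ℤ ^ k ∣ ℕ.* ∣ x ∣)  ≡⟨ cong +_ (ℤ.abs-* (-1ℤ ^ k) x) ⟨
  + ∣ -1ℤ ^ k * x ∣          ≡⟨ ℤ.0≤i⇒+∣i∣≡i 0≤x ⟩
  -1ℤ ^ k * x                ∎
  where open ℤ.≤-Reasoning

-- Updates at one vertex and products over all vertices.

at : ∀ {n} {A : Set} → Fin n → (A → A) → (Fin n → A) → Fin n → A
at u φ x w = if does (u Fin.≟ w) then φ (x w) else x w

at-suc : ∀ {n} (u : Fin n) x w → at u suc x w ≡ indicator (u Fin.≟ w) ℕ.+ x w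
at-suc u x w with does (u Fin.≟ w)
... | true  = refl
... | false = refl

sum-at-suc : ∀ {n} (u : Fin n) x → sum (at u suc x) ≡ suc (sum x)
sum-at-suc zero    x = refl
sum-at-suc (suc u) x = trans (cong (x zero ℕ.+_) (sum-at-suc u (λ w → x (suc w)))) (ℕ.+-suc (x zero) _)

-- Multilinearity of the product, in the factor at u.
product-split : ∀ {n} (u : Fin n) {a b c : Fin n → ℤ} → a u ≡ b u + c u →
  (∀ w → u ≢ w → a w ≡ b w × a w ≡ c w) → product a ≡ product b + product c
product-split zero {a} {b} {c} a≡b+c a≡b,c = begin
  a zero * product (λ w → a (suc w))
    ≡⟨ cong (_* product (λ w → a (suc w))) a≡b+c ⟩
  (b zero + c zero) * product (λ w → a (suc w))
    ≡⟨ ℤ.*-distribʳ-+ (product (λ w → a (suc w))) (b zero) (c zero) ⟩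
  b zero * product (λ w → a (suc w)) + c zero * product (λ w → a (suc w))
    ≡⟨ cong₂ (λ y z → b zero * y + c zero * z)
         (product-cong (λ w → proj₁ (a≡b,c (suc w) λ ())))
         (product-cong (λ w → proj₂ (a≡b,c (suc w) λ ()))) ⟩
  product b + product c ∎
  where open ≡-Reasoning
product-split (suc u) {a} {b} {c} a≡b+c a≡b,c = begin
  a zero * product (λ w → a (suc w))
    ≡⟨ cong (λ z → a zero * z) (product-split u a≡b+c
         (λ w u≢w → a≡b,c (suc w) (λ eq → u≢w (Fin.suc-injective eq)))) ⟩
  a zero * (product (λ w → b (suc w)) + product (λ w → c (suc w)))
    ≡⟨ ℤ.*-distribˡ-+ (a zero) (product (λ w → b (suc w))) (product (λ w → c (suc w))) ⟩
  a zero * product (λ w → b (suc w)) + a zero * product (λ w → c (suc w))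
    ≡⟨ cong₂ (λ y z → y * product (λ w → b (suc w)) + z * product (λ w → c (suc w)))
         (proj₁ (a≡b,c zero λ ())) (proj₂ (a≡b,c zero λ ())) ⟩
  product b + product c ∎
  where open ≡-Reasoning

-- Powers of i rather than signs are tracked because a single `q v` may be odd, its factor then
-- being zero; the exponents simply add up.
product-phase : ∀ {n} (q : Fin n → ℕ) (a : Fin n → ℤ) → (∀ v → HasPhase (q v) (a v)) →
  HasPhase (sum q) (product a)
product-phase {zero}  q a phases = inj₂ (0 , refl , +≤+ z≤n)
product-phase {suc n} q a phases =
  phase-* (phases zero) (product-phase (λ v → q (suc v)) (λ v → a (suc v)) (λ v → phases (suc v)))

product-one : ∀ {n} {a : Fin n → ℤ} → (∀ v → a v ≡ 1ℤ) → product a ≡ 1ℤ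
product-one {zero}  a≡1 = refl
product-one {suc n} a≡1 = cong₂ _*_ (a≡1 zero) (product-one (λ v → a≡1 (suc v)))

product-zero : ∀ {n} {a : Fin n → ℤ} v → a v ≡ 0ℤ → product a ≡ 0ℤ
product-zero {a = a} zero    a≡0 = cong (_* product (λ w → a (suc w))) a≡0
product-zero {a = a} (suc v) a≡0 =
  trans (cong (λ z → a zero * z) (product-zero v a≡0)) (ℤ.*-zeroʳ (a zero))

-- Counting by filtered lists.

length-filter-tabulate : ∀ {m} {A : Set} {P : Pred A 0ℓ} (P? : Decidable P) (f : Fin m → A) →
  length (filter P? (tabulate f)) ≡ sum (λ i → indicator (P? (f i)))
length-filter-tabulate {zero}  P? f = refl
length-filter-tabulate {suc m} P? f with does (P? (f zero))
... | true  = cong suc (length-filter-tabulate P? (λ i → f (suc i)))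
... | false = length-filter-tabulate P? (λ i → f (suc i))

length-filter-singleton : ∀ {A : Set} {P : Pred A 0ℓ} (P? : Decidable P) x →
  length (filter P? (x ∷ [])) ≡ indicator (P? x)
length-filter-singleton P? x with does (P? x)
... | true  = refl
... | false = refl

length-filter-map : ∀ {A B : Set} {P : Pred B 0ℓ} (P? : Decidable P) (f : A → B) xs →
  length (filter P? (map f xs)) ≡ length (filter (λ x → P? (f x)) xs)
length-filter-map P? f []       = refl
length-filter-map P? f (x ∷ xs) with does (P? (f x))
... | true  = cong suc (length-filter-map P? f xs)
... | false = length-filter-map P? f xs

length-filter-cartesianProductWith : ∀ {A B C : Set} {P : Pred C 0ℓ} (P? : Decidable P)
  (f : A → B → C) xs ys →
  length (filter P? (cartesianProductWith f xs ys)) ≡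
  List.sum (map (λ x → length (filter (λ y → P? (f x y)) ys)) xs)
length-filter-cartesianProductWith P? f []       ys = refl
length-filter-cartesianProductWith P? f (x ∷ xs) ys = begin
  length (filter P? (map (f x) ys ++ cartesianProductWith f xs ys))
    ≡⟨ cong length (filter-++ P? (map (f x) ys) _) ⟩
  length (filter P? (map (f x) ys) ++ filter P? (cartesianProductWith f xs ys))
    ≡⟨ length-++ (filter P? (map (f x) ys)) ⟩
  length (filter P? (map (f x) ys)) ℕ.+ length (filter P? (cartesianProductWith f xs ys))
    ≡⟨ cong₂ ℕ._+_ (length-filter-map P? (f x) ys) (length-filter-cartesianProductWith P? f xs ys) ⟩
  _ ∎
  where open ≡-Reasoning

-- Multilinear functionals and the operators of the edges.

module _ {n : ℕ} where

  -- A state stands for the product of the polynomials `F v` in separate variables x_v, that is, for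
  -- a pure tensor. Polynomials in several variables appear only through functionals on states.
  State : Set
  State = Fin n → Poly

  -- Expresses F = G + H for pure tensors that differ in the slot u alone; a functional respecting
  -- all such relations is `Linear`.
  record Split (u : Fin n) (F G H : State) : Set where
    constructor split
    field
      here      : ∀ j → F u j ≡ G u j + H u j
      elsewhere : ∀ w → u ≢ w → F w ≗ G w × F w ≗ H w

  Linear : (State → ℤ) → Set
  Linear k = ∀ {u F G H} → Split u F G H → k F ≡ k G + k H

  at-X·-split : ∀ {u F G H} v → Split u F G H → Split u (at v X·_ F) (at v X·_ G) (at v X·_ H)
  at-X·-split {u} {F} {G} {H} v (split F≡G+H F≗G,H) = split here′ elsewhere′
    where
    here′ : ∀ j → at v X·_ F u j ≡ at v X·_ G u j + at v X·_ H u j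
    here′ with does (v Fin.≟ u)
    ... | true  = X·-+ F≡G+H
    ... | false = F≡G+H
    elsewhere′ : ∀ w → u ≢ w → at v X·_ F w ≗ at v X·_ G w × at v X·_ F w ≗ at v X·_ H w
    elsewhere′ w u≢w with does (v Fin.≟ w)
    ... | true  = X·-cong (proj₁ (F≗G,H w u≢w)) , X·-cong (proj₂ (F≗G,H w u≢w))
    ... | false = F≗G,H w u≢w

  [1+X]·-split : ∀ u F → Split u (at u [1+X]·_ F) F (at u X·_ F)
  [1+X]·-split u F = split here′ elsewhere′
    where
    here′ : ∀ j → at u [1+X]·_ F u j ≡ F u j + at u X·_ F u j
    here′ j with u Fin.≟ u
    ... | yes _  = refl
    ... | no u≢u = contradiction refl u≢u
    elsewhere′ : ∀ w → u ≢ w → at u [1+X]·_ F w ≗ F w × at u [1+X]·_ F w ≗ at u X·_ F w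
    elsewhere′ w u≢w with u Fin.≟ w
    ... | yes u≡w = contradiction u≡w u≢w
    ... | no _    = (λ _ → refl) , λ _ → refl

  -- Put as F = (1 - x) F + x F because `Linear` speaks of sums; the value at (1 - x) F is then
  -- obtained by subtraction.
  [1-X]·-split : ∀ u F → Split u F (at u [1-X]·_ F) (at u X·_ F)
  [1-X]·-split u F = split here′ elsewhere′
    where
    lemma : ∀ a b → a ≡ a - b + b
    lemma = solve-∀
    here′ : ∀ j → F u j ≡ at u [1-X]·_ F u j + at u X·_ F u j
    here′ j with u Fin.≟ u
    ... | yes _  = lemma (F u j) ((X· F u) j)
    ... | no u≢u = contradiction refl u≢u
    elsewhere′ : ∀ w → u ≢ w → F w ≗ at u [1-X]·_ F w × F w ≗ at u X·_ F w
    elsewhere′ w u≢w with u Fin.≟ w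
    ... | yes u≡w = contradiction u≡w u≢w
    ... | no _    = (λ _ → refl) , λ _ → refl

  -- With S_v denoting multiplication by x at the vertex v, an o-edge uv acts
  -- as S_u + S_v and an s-edge as 1 + S_u S_v.
  edgeSum : Label → Fin n → Fin n → (State → ℤ) → State → ℤ
  edgeSum o u v k F = k (at v X·_ F) + k (at u X·_ F)
  edgeSum s u v k F = k (at u X·_ (at v X·_ F)) + k F

  edgeSum-linear : ∀ l u v {k} → Linear k → Linear (edgeSum l u v k)
  edgeSum-linear o u v {k} lin {F = F} {G} {H} F=G+H =
    trans (cong₂ _+_ (lin (at-X·-split v F=G+H)) (lin (at-X·-split u F=G+H)))
      (interchange (k (at v X·_ G)) (k (at v X·_ H)) (k (at u X·_ G)) (k (at u X·_ H)))
  edgeSum-linear s u v {k} lin {F = F} {G} {H} F=G+H =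
    trans (cong₂ _+_ (lin (at-X·-split u (at-X·-split v F=G+H))) (lin F=G+H))
      (interchange (k (at u X·_ (at v X·_ G))) (k (at u X·_ (at v X·_ H))) (k G) (k H))

  edgeSign : Label → ℤ
  edgeSign o = -1ℤ
  edgeSign s = 1ℤ

  -- 2 (S_u + S_v) = P_u P_v - Q_u Q_v  and  2 (1 + S_u S_v) = P_u P_v + Q_u Q_v
  -- for P = 1 + S and Q = 1 - S.
  edgeSum-double : ∀ l u v {k} → Linear k → ∀ F →
    + 2 * edgeSum l u v k F ≡
    k (at u [1+X]·_ (at v [1+X]·_ F)) + edgeSign l * k (at u [1-X]·_ (at v [1-X]·_ F))
  edgeSum-double l u v {k} lin F = begin
    + 2 * edgeSum l u v k F
      ≡⟨ combine l ⟩
    a + b + (c + d) + edgeSign l * (a - b - (c - d))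
      ≡⟨ cong₂ (λ y z → y + edgeSign l * z) plus minus ⟨
    k (at u [1+X]·_ (at v [1+X]·_ F)) + edgeSign l * k (at u [1-X]·_ (at v [1-X]·_ F)) ∎
    where
    open ≡-Reasoning
    a = k F
    b = k (at v X·_ F)
    c = k (at u X·_ F)
    d = k (at u X·_ (at v X·_ F))
    combine-o : ∀ a b c d → + 2 * (b + c) ≡ a + b + (c + d) + -1ℤ * (a - b - (c - d))
    combine-o = solve-∀
    combine-s : ∀ a b c d → + 2 * (d + a) ≡ a + b + (c + d) + 1ℤ * (a - b - (c - d))
    combine-s = solve-∀
    combine : ∀ l → + 2 * edgeSum l u v k F ≡ a + b + (c + d) + edgeSign l * (a - b - (c - d))
    combine o = combine-o a b c d
    combine s = combine-s a b c d
    plus : k (at u [1+X]·_ (at v [1+X]·_ F)) ≡ a + b + (c + d)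
    plus = trans (lin ([1+X]·-split u _))
      (cong₂ _+_ (lin ([1+X]·-split v F)) (lin (at-X·-split u ([1+X]·-split v F))))
    difference : ∀ x y z → x ≡ y + z → y ≡ x - z
    difference x y z x≡y+z = trans (lemma y z) (cong (_- z) (sym x≡y+z))
      where
      lemma : ∀ y z → y ≡ y + z - z
      lemma = solve-∀
    minus : k (at u [1-X]·_ (at v [1-X]·_ F)) ≡ a - b - (c - d)
    minus = trans (difference _ _ (k (at u X·_ (at v [1-X]·_ F))) (lin ([1-X]·-split u (at v [1-X]·_ F))))
      (cong₂ _-_ (difference a (k (at v [1-X]·_ F)) b (lin ([1-X]·-split v F)))
                 (difference c (k (at u X·_ (at v [1-X]·_ F))) d (lin (at-X·-split u ([1-X]·-split v F)))))

  IsPower : State → (p q : Fin n → ℕ) → Set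
  IsPower F p q = ∀ w → F w ≗ [1+X]^ p w ·[1-X]^ q w

  isPower-[1+X]· : ∀ u F p q → IsPower F p q → IsPower (at u [1+X]·_ F) (at u suc p) q
  isPower-[1+X]· u F p q F≗ w with does (u Fin.≟ w)
  ... | true  = [1+X]·-cong (F≗ w)
  ... | false = F≗ w

  isPower-[1-X]· : ∀ u F p q → IsPower F p q → IsPower (at u [1-X]·_ F) p (at u suc q)
  isPower-[1-X]· u F p q F≗ w with does (u Fin.≟ w)
  ... | true  = λ j → trans ([1-X]·-cong (F≗ w) j) ([1-X]·-power (p w) (q w) j)
  ... | false = F≗ w

  -- Choices at an edge as monomial factors.

  placed : ∀ l → Fin n → Fin n → Choice l → State → State
  placed o u v towardsTgt F = at v X·_ F
  placed o u v towardsSrc F = at u X·_ F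
  placed s u v selected   F = at u X·_ (at v X·_ F)
  placed s u v unselected F = F

  load : ∀ l → Fin n → Fin n → Choice l → Fin n → ℕ
  load o u v towardsTgt w = indicator (v Fin.≟ w)
  load o u v towardsSrc w = indicator (u Fin.≟ w)
  load s u v selected   w = indicator (u Fin.≟ w) ℕ.+ indicator (v Fin.≟ w)
  load s u v unselected w = 0

  -- Counts edge ends, so that every edge adds one indicator for each of its ends; looplessness
  -- identifies this with the degree in `degree-valence`.
  valence : ∀ {m} → (src tgt : Fin m → Fin n) → Fin n → ℕ
  valence src tgt v = sum (λ e → indicator (src e Fin.≟ v) ℕ.+ indicator (tgt e Fin.≟ v))

  loads : ∀ {m} (l : Fin m → Label) (src tgt : Fin m → Fin n) → (∀ e → Choice (l e)) → Fin n → ℕ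
  loads l src tgt φ v = sum (λ e → load (l e) (src e) (tgt e) (φ e) v)

  edgeSum-choices : ∀ l u v k F (c : Choice l → ℕ) → (∀ x → + c x ≡ k (placed l u v x F)) →
    + List.sum (map c (allChoices l)) ≡ edgeSum l u v k F
  edgeSum-choices o u v k F c c≡
    rewrite ℕ.+-identityʳ (c towardsSrc) = cong₂ _+_ (c≡ towardsTgt) (c≡ towardsSrc)
  edgeSum-choices s u v k F c c≡
    rewrite ℕ.+-identityʳ (c unselected) = cong₂ _+_ (c≡ selected) (c≡ unselected)

  X·-monomial : ∀ a → X· monomial a ≗ monomial (suc a)
  X·-monomial a zero    = refl
  X·-monomial a (suc j) = refl

  IsMonomial : State → (Fin n → ℕ) → Set
  IsMonomial F κ = ∀ w → F w ≗ monomial (κ w)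

  at-X·-monomial : ∀ u F κ → IsMonomial F κ →
    IsMonomial (at u X·_ F) (λ w → indicator (u Fin.≟ w) ℕ.+ κ w)
  at-X·-monomial u F κ F≗ w with does (u Fin.≟ w)
  ... | true  = λ j → trans (X·-cong (F≗ w) j) (X·-monomial (κ w) j)
  ... | false = F≗ w

  placed-monomial : ∀ l u v x F κ → IsMonomial F κ →
    IsMonomial (placed l u v x F) (λ w → load l u v x w ℕ.+ κ w)
  placed-monomial o u v towardsTgt F κ F≗     = at-X·-monomial v F κ F≗
  placed-monomial o u v towardsSrc F κ F≗     = at-X·-monomial u F κ F≗
  placed-monomial s u v unselected F κ F≗     = F≗
  placed-monomial s u v selected   F κ F≗ w j =
    trans (at-X·-monomial u (at v X·_ F) (λ w → indicator (v Fin.≟ w) ℕ.+ κ w) (at-X·-monomial v F κ F≗) w j)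
      (cong (λ a → monomial a j) (sym (ℕ.+-assoc (indicator (u Fin.≟ w)) _ (κ w))))

  -- The coefficient of the product over the edges, its bound and its meaning.

  module _ (h : Fin n → ℕ) where

    -- The coefficient of ∏ x_v^(h v) in the product of F and all edge factors. Once no edge is
    -- left, it is a product of coefficients, one per vertex.
    total : ∀ {m} → (Fin m → Label) → (src tgt : Fin m → Fin n) → State → ℤ
    total {zero}  l src tgt F = product (λ v → F v (h v))
    total {suc m} l src tgt   =
      edgeSum (l zero) (src zero) (tgt zero)
        (total (λ e → l (suc e)) (λ e → src (suc e)) (λ e → tgt (suc e)))

    total-linear : ∀ {m} l src tgt → Linear (total {m} l src tgt)
    total-linear {zero} l src tgt {u} (split F≡G+H F≗G,H) =
      product-split u (F≡G+H (h u))
        (λ w u≢w → proj₁ (F≗G,H w u≢w) (h w) , proj₂ (F≗G,H w u≢w) (h w))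
    total-linear {suc m} l src tgt =
      edgeSum-linear (l zero) (src zero) (tgt zero)
        (total-linear (λ e → l (suc e)) (λ e → src (suc e)) (λ e → tgt (suc e)))

    -- Induction over the edges, each replaced by P_u P_v ± Q_u Q_v. The label only affects the
    -- sign, which the triangle inequality discards on the left. The size condition makes the
    -- coefficients reached at the end middle ones, and `k` counts the pairs Q_u Q_v used, so the
    -- final product has sign (-1)^k or is zero.
    total-dominated : ∀ {m} (l : Fin m → Label) src tgt F p q k →
      IsPower F p q → (∀ v → p v ℕ.+ q v ℕ.+ valence src tgt v ≡ 2 ℕ.* h v) → sum q ≡ 2 ℕ.* k →
      + ∣ total l src tgt F ∣ ℤ.≤ -1ℤ ^ k * total (λ _ → o) src tgt F
    total-dominated {zero} l src tgt F p q k F≗ size ∑q≡2k =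
      phase-abs k (subst (λ j → HasPhase j (total l src tgt F)) ∑q≡2k
        (product-phase q _ λ v → subst (HasPhase (q v)) (sym (F≗ v (h v)))
          (middle-phase (q v) (p v) (h v) (trans (sym (ℕ.+-identityʳ _)) (size v)))))
    total-dominated {suc m} l src tgt F p q k F≗ size ∑q≡2k =
      ℤ.*-cancelˡ-≤-pos (+ ∣ x ∣) _ (+ 2) (begin
        + 2 * + ∣ x ∣                     ≡⟨ ℤ.pos-* 2 ∣ x ∣ ⟨
        + (2 ℕ.* ∣ x ∣)                   ≡⟨ cong +_ (ℤ.abs-* (+ 2) x) ⟨
        + ∣ + 2 * x ∣                     ≡⟨ cong (λ z → + ∣ z ∣) (edgeSum-double (l zero) u v (total-linear l′ src′ tgt′) F) ⟩
        + ∣ τ F⁺ + edgeSign (l zero) * τ F⁻ ∣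
                                          ≤⟨ +≤+ (ℤ.∣i+j∣≤∣i∣+∣j∣ (τ F⁺) _) ⟩
        + ∣ τ F⁺ ∣ + + ∣ edgeSign (l zero) * τ F⁻ ∣
                                          ≡⟨ cong (λ z → + ∣ τ F⁺ ∣ + + z) (abs-edgeSign (l zero) (τ F⁻)) ⟩
        + ∣ τ F⁺ ∣ + + ∣ τ F⁻ ∣           ≤⟨ ℤ.+-mono-≤
            (total-dominated l′ src′ tgt′ F⁺ p⁺ q k
              (isPower-[1+X]· u _ (at v suc p) q (isPower-[1+X]· v F p q F≗)) size⁺ ∑q≡2k)
            -- Two more factors 1 - x mean one more sign, which is exactly the -1 in front of Q_u
            -- Q_v for an `o`-edge; so the right-hand side loses nothing.
            (total-dominated l′ src′ tgt′ F⁻ p q⁺ (suc k)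
              (isPower-[1-X]· u _ p (at v suc q) (isPower-[1-X]· v F p q F≗)) size⁻ ∑q⁺) ⟩
        -1ℤ ^ k * τₒ F⁺ + -1ℤ * -1ℤ ^ k * τₒ F⁻
                                          ≡⟨ factor (-1ℤ ^ k) (τₒ F⁺) (τₒ F⁻) ⟩
        -1ℤ ^ k * (τₒ F⁺ + -1ℤ * τₒ F⁻)   ≡⟨ cong (λ z → -1ℤ ^ k * z) (edgeSum-double o u v (total-linear (λ _ → o) src′ tgt′) F) ⟨
        -1ℤ ^ k * (+ 2 * y)               ≡⟨ swap (-1ℤ ^ k) y ⟩
        + 2 * (-1ℤ ^ k * y)               ∎)
      where
      open ℤ.≤-Reasoning
      u = src zero
      v = tgt zero
      l′   = λ e → l (suc e)
      src′ = λ e → src (suc e)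
      tgt′ = λ e → tgt (suc e)
      τ  = total l′ src′ tgt′
      τₒ = total (λ _ → o) src′ tgt′
      F⁺ = at u [1+X]·_ (at v [1+X]·_ F)
      F⁻ = at u [1-X]·_ (at v [1-X]·_ F)
      p⁺ = at u suc (at v suc p)
      q⁺ = at u suc (at v suc q)
      x = total l src tgt F
      y = total (λ _ → o) src tgt F
      factor : ∀ e a b → e * a + -1ℤ * e * b ≡ e * (a + -1ℤ * b)
      factor = solve-∀
      swap : ∀ e y → e * (+ 2 * y) ≡ + 2 * (e * y)
      swap = solve-∀
      abs-edgeSign : ∀ l z → ∣ edgeSign l * z ∣ ≡ ∣ z ∣
      abs-edgeSign o z = trans (ℤ.abs-* -1ℤ z) (ℕ.*-identityˡ ∣ z ∣)
      abs-edgeSign s z = cong ∣_∣ (ℤ.*-identityˡ z)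
      at-suc² : ∀ r w → at u suc (at v suc r) w ≡ indicator (u Fin.≟ w) ℕ.+ (indicator (v Fin.≟ w) ℕ.+ r w)
      at-suc² r w = trans (at-suc u (at v suc r) w) (cong (indicator (u Fin.≟ w) ℕ.+_) (at-suc v r w))
      size⁺ : ∀ w → p⁺ w ℕ.+ q w ℕ.+ valence src′ tgt′ w ≡ 2 ℕ.* h w
      size⁺ w rewrite at-suc² p w =
        trans (lemma (indicator (u Fin.≟ w)) (indicator (v Fin.≟ w)) (p w) (q w) _) (size w)
        where
        lemma : ∀ a b p q d → a ℕ.+ (b ℕ.+ p) ℕ.+ q ℕ.+ d ≡ p ℕ.+ q ℕ.+ (a ℕ.+ b ℕ.+ d)
        lemma = ℕSolver.solve-∀
      size⁻ : ∀ w → p w ℕ.+ q⁺ w ℕ.+ valence src′ tgt′ w ≡ 2 ℕ.* h w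
      size⁻ w rewrite at-suc² q w =
        trans (lemma (indicator (u Fin.≟ w)) (indicator (v Fin.≟ w)) (p w) (q w) _) (size w)
        where
        lemma : ∀ a b p q d → p ℕ.+ (a ℕ.+ (b ℕ.+ q)) ℕ.+ d ≡ p ℕ.+ q ℕ.+ (a ℕ.+ b ℕ.+ d)
        lemma = ℕSolver.solve-∀
      ∑q⁺ : sum q⁺ ≡ 2 ℕ.* suc k
      ∑q⁺ = trans (sum-at-suc u (at v suc q)) (trans (cong suc (sum-at-suc v q))
        (trans (cong (λ z → suc (suc z)) ∑q≡2k) (sym (ℕ.*-suc 2 k))))

    -- A product of Kronecker deltas is the indicator of their conjunction: one vertex with κ ≠ h
    -- makes it zero.
    product-monomial : ∀ F κ {A : Set} (a? : Dec A) →
      (A → ∀ v → κ v ≡ h v) → ((∀ v → κ v ≡ h v) → A) → IsMonomial F κ →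
      + indicator a? ≡ product (λ v → F v (h v))
    product-monomial F κ (yes a) a⇒ ⇒a F≗ =
      sym (product-one λ v → trans (F≗ v (h v)) (cong +_ (indicator-yes (κ v ℕ.≟ h v) (a⇒ a v))))
    product-monomial F κ (no ¬a) a⇒ ⇒a F≗
      with v , κ≢h ← Fin.¬∀⟶∃¬ n _ (λ v → κ v ℕ.≟ h v) (λ κ≡h → ¬a (⇒a κ≡h))
      = sym (product-zero v (trans (F≗ v (h v)) (cong +_ (indicator-no (κ v ℕ.≟ h v) κ≢h))))

    -- The enumeration branches on the first edge just as `edgeSum` does, and `κ` collects the loads
    -- of the edges already decided. The predicate is kept general up to equivalence so that the
    -- induction can fix the first choice inside it.
    total-counts : ∀ {m} (l : Fin m → Label) (src tgt : Fin m → Fin n) F κ →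
      {P : Pred (∀ e → Choice (l e)) 0ℓ} (P? : Decidable P) →
      P ≐ (λ φ → ∀ v → κ v ℕ.+ loads l src tgt φ v ≡ h v) → IsMonomial F κ →
      + length (filter P? (functions (λ e → allChoices (l e)))) ≡ total l src tgt F
    total-counts {zero} l src tgt F κ P? (P⇒ , ⇒P) F≗ =
      trans (cong +_ (length-filter-singleton P? _))
        (product-monomial F κ (P? _) (λ Pφ v → trans (sym (ℕ.+-identityʳ (κ v))) (P⇒ Pφ v))
          (λ κ≡h → ⇒P λ v → trans (ℕ.+-identityʳ (κ v)) (κ≡h v)) F≗)
    total-counts {suc m} l src tgt F κ {P} P? (P⇒ , ⇒P) F≗ =
      trans (cong +_ (length-filter-cartesianProductWith P? consᶠ (allChoices (l zero)) _))
        (edgeSum-choices (l zero) (src zero) (tgt zero) _ F _ λ x →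
          total-counts _ _ _ _ (λ v → load (l zero) (src zero) (tgt zero) x v ℕ.+ κ v)
            (λ φ → P? (consᶠ x φ))
            ( (λ {φ} Pφ v → trans (move (load _ _ _ x v) (κ v) _) (P⇒ Pφ v))
            , (λ {φ} eq → ⇒P λ v → trans (sym (move (load _ _ _ x v) (κ v) _)) (eq v)))
            (placed-monomial (l zero) (src zero) (tgt zero) x F κ F≗))
      where
      move : ∀ a b c → a ℕ.+ b ℕ.+ c ≡ b ℕ.+ (a ℕ.+ c)
      move = ℕSolver.solve-∀

-- Degrees, mixed degrees and Eulerian orientations of a graph.

module _ (G : Graph) where
  open Graph G hiding (Eulerian)

  -- In a loopless graph at most one end of e is v, so the disjunction of the two cases counts as
  -- their sum.
  incident-ends : ∀ v e → indicator (incident? v e) ≡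
    indicator (src e Fin.≟ v) ℕ.+ indicator (tgt e Fin.≟ v)
  incident-ends v e with src e Fin.≟ v | tgt e Fin.≟ v
  ... | yes refl | yes t≡v = contradiction (sym t≡v) (loopless e)
  ... | yes _    | no _    = refl
  ... | no _     | yes _   = refl
  ... | no _     | no _    = refl

  degree-valence : ∀ v → degree v ≡ valence src tgt v
  degree-valence v =
    trans (length-filter-tabulate (incident? v) (λ e → e)) (sum-cong-≗ (incident-ends v))

  mixedDegree-loads : ∀ lab φ v → mixedDegree G lab φ v ≡ loads lab src tgt φ v
  mixedDegree-loads lab φ v = begin
    mixedDegree G lab φ v
      ≡⟨ cong₂ ℕ._+_ (length-filter-tabulate (λ e → orientedTowards? G v e (lab e) (φ e)) (λ e → e))
                     (length-filter-tabulate (λ e → selectedAt? G v e (lab e) (φ e)) (λ e → e)) ⟩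
    sum (λ e → indicator (orientedTowards? G v e (lab e) (φ e))) ℕ.+
    sum (λ e → indicator (selectedAt? G v e (lab e) (φ e)))
      ≡⟨ ∑-distrib-+ (λ e → indicator (orientedTowards? G v e (lab e) (φ e)))
                     (λ e → indicator (selectedAt? G v e (lab e) (φ e))) ⟨
    sum (λ e → indicator (orientedTowards? G v e (lab e) (φ e)) ℕ.+
               indicator (selectedAt? G v e (lab e) (φ e)))
      ≡⟨ sum-cong-≗ (λ e → pointwise e (lab e) (φ e)) ⟩
    loads lab src tgt φ v ∎
    where
    open ≡-Reasoning
    pointwise : ∀ e l c →
      indicator (orientedTowards? G v e l c) ℕ.+ indicator (selectedAt? G v e l c) ≡
      load l (src e) (tgt e) c v
    pointwise e o towardsTgt = ℕ.+-identityʳ _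
    pointwise e o towardsSrc = ℕ.+-identityʳ _
    pointwise e s selected   = incident-ends v e
    pointwise e s unselected = refl

  inDegree-mixedDegree : ∀ ω v → mixedDegree G (λ _ → o) ω v ≡ inDegree G ω v
  inDegree-mixedDegree ω v =
    trans (cong (inDegree G ω v ℕ.+_)
            (trans (length-filter-tabulate (λ e → selectedAt? G v e o (ω e)) (λ e → e))
                   (sum-replicate-zero size)))
          (ℕ.+-identityʳ _)

  inDegree+outDegree : ∀ ω v → inDegree G ω v ℕ.+ outDegree G ω v ≡ degree v
  inDegree+outDegree ω v = begin
    inDegree G ω v ℕ.+ outDegree G ω v
      ≡⟨ cong₂ ℕ._+_ (length-filter-tabulate (λ e → head G e (ω e) Fin.≟ v) (λ e → e))
                     (length-filter-tabulate (λ e → tail G e (ω e) Fin.≟ v) (λ e → e)) ⟩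
    sum (λ e → indicator (head G e (ω e) Fin.≟ v)) ℕ.+ sum (λ e → indicator (tail G e (ω e) Fin.≟ v))
      ≡⟨ ∑-distrib-+ (λ e → indicator (head G e (ω e) Fin.≟ v))
                     (λ e → indicator (tail G e (ω e) Fin.≟ v)) ⟨
    sum (λ e → indicator (head G e (ω e) Fin.≟ v) ℕ.+ indicator (tail G e (ω e) Fin.≟ v))
      ≡⟨ sum-cong-≗ (λ e → ends e (ω e)) ⟩
    valence src tgt v
      ≡⟨ degree-valence v ⟨
    degree v ∎
    where
    open ≡-Reasoning
    ends : ∀ e d → indicator (head G e d Fin.≟ v) ℕ.+ indicator (tail G e d Fin.≟ v) ≡
      indicator (src e Fin.≟ v) ℕ.+ indicator (tgt e Fin.≟ v)
    ends e towardsTgt = ℕ.+-comm (indicator (tgt e Fin.≟ v)) _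
    ends e towardsSrc = refl

  module _ (eulerian : Eulerian G) where

    half : Vertex → ℕ
    half v = degree v / 2

    2*half : ∀ v → 2 ℕ.* half v ≡ degree v
    2*half v = m*[n/m]≡n (eulerian v)

    -- In-degree and out-degree add up to the degree, so they agree exactly when the in-degree is
    -- half of it.
    eulerian≐balanced : IsEulerianOrientation G ≐ Balanced G (λ _ → o)
    eulerian≐balanced = (λ {ω} → to {ω}) , (λ {ω} → from {ω})
      where
      open ≡-Reasoning
      sum-of-halves : ∀ ω v → inDegree G ω v ℕ.+ outDegree G ω v ≡ half v ℕ.+ half v
      sum-of-halves ω v = trans (inDegree+outDegree ω v)
        (trans (sym (2*half v)) (cong (half v ℕ.+_) (ℕ.+-identityʳ _)))
      to : ∀ {ω} → IsEulerianOrientation G ω → Balanced G (λ _ → o) ω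
      to {ω} in≡out v = trans (inDegree-mixedDegree ω v)
        (ℕ.*-cancelˡ-≡ _ _ 2 (begin
          2 ℕ.* inDegree G ω v                 ≡⟨ cong (inDegree G ω v ℕ.+_) (ℕ.+-identityʳ _) ⟩
          inDegree G ω v ℕ.+ inDegree G ω v    ≡⟨ cong (inDegree G ω v ℕ.+_) (in≡out v) ⟩
          inDegree G ω v ℕ.+ outDegree G ω v   ≡⟨ inDegree+outDegree ω v ⟩
          degree v                             ≡⟨ 2*half v ⟨
          2 ℕ.* half v                         ∎))
      from : ∀ {ω} → Balanced G (λ _ → o) ω → IsEulerianOrientation G ω
      from {ω} balanced v = trans in≡half (sym (ℕ.+-cancelˡ-≡ (half v) _ _
        (trans (cong (ℕ._+ outDegree G ω v) (sym in≡half)) (sum-of-halves ω v))))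
        where
        in≡half : inDegree G ω v ≡ half v
        in≡half = trans (sym (inDegree-mixedDegree ω v)) (balanced v)

    -- Both counts filter the same list, as `allChoices o` is `allDirections`; it remains to compare
    -- the predicates.
    ε≡g : ε G ≡ g G (λ _ → o)
    ε≡g = cong length (filter-≐ (isEulerianOrientation? G) (balanced? G (λ _ → o))
      eulerian≐balanced (functions (λ _ → allDirections)))

    initial : Vertex → Poly
    initial _ = monomial 0

    g≡total : ∀ lab → + g G lab ≡ total half lab src tgt initial
    g≡total lab = total-counts half lab src tgt initial (λ _ → 0) (balanced? G lab)
      ( (λ {φ} balanced v → trans (sym (mixedDegree-loads lab φ v)) (balanced v))
      , (λ {φ} loads≡ v → trans (mixedDegree-loads lab φ v) (loads≡ v)))
      (λ _ _ → refl)

theorem1p10 : (G : Graph) → Eulerian G → (lab : Labelling G) → g G lab ≤ ε G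
theorem1p10 G eulerian lab = ℤ.drop‿+≤+ (begin
  -- A count is nonnegative, so it equals its absolute value.
  + g G lab                                         ≡⟨ cong (λ z → + ∣ z ∣) (g≡total G eulerian lab) ⟩
  -- At the start no factor 1 + x or 1 - x is present: p = q = 0 everywhere, k = 0, and the size
  -- condition is that the degree is twice its half.
  + ∣ total h lab src tgt F ∣                       ≤⟨ total-dominated h lab src tgt F (λ _ → 0) (λ _ → 0) 0
                                                         (λ _ _ → refl)
                                                         (λ v → trans (sym (degree-valence G v)) (sym (2*half G eulerian v)))
                                                         (sum-replicate-zero order) ⟩
  1ℤ * total h (λ _ → o) src tgt F                  ≡⟨ ℤ.*-identityˡ _ ⟩
  total h (λ _ → o) src tgt F                       ≡⟨ g≡total G eulerian (λ _ → o) ⟨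
  + g G (λ _ → o)                                   ≡⟨ cong +_ (ε≡g G eulerian) ⟨
  + ε G                                             ∎)
  where
  open ℤ.≤-Reasoning
  open Graph G using (order; src; tgt)
  h = half G eulerian
  F = initial G eulerian
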